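{- Suppose there exists a constant $\alpha$ such that for every Boolean function $f:\{0,1\}^n\to\{0,1\}$ (for every $n$), $\mathsf{mbs}(f)=O(\log^{\alpha}\mathsf{spar}(f))$. Then for every Boolean function $f:\{0,1\}^n\to\{0,1\}$, $\mathsf{s}(f)=O(\deg^{\alpha}(f))$.
   Context: Every $f:\{0,1\}^n\to\{0,1\}$ has a unique multilinear representation $f(x)=\sum_{S\subseteq[n]}\alpha_S\prod_{i\in S}x_i$ over $\mathbb{R}$; $\mathsf{spar}(f)=|\{S\neq\emptyset:\alpha_S\neq 0\}|$ and $\deg(f)=\max\{|S|:\alpha_S\ne0\}$. Sensitivity: $\mathsf{s}(f,x)=|\{i: f(x^{\oplus i})\ne f(x)\}|$ where $x^{\oplus i}$ flips bit $i$, and $\mathsf{s}(f)=\max_x\mathsf{s}(f,x)$. For $x$, with $\mathrm{supp}(x)=\{i:x_i=1\}$ and $x^B$ denoting $x$ with the bits in $B$ flipped, a monotone sensitive block at $x$ is a nonempty $B\subseteq[n]\setminus\mathrm{supp}(x)$ with $f(x^B)\ne f(x)$; $\mathsf{mbs}(f,x)$ is the maximum number of pairwise disjoint monotone sensitive blocks at $x$, and $\mathsf{mbs}(f)=\max_x\mathsf{mbs}(f,x)$.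
   Formalization: The exponent α is restricted to nonnegative rational numbers p/q instead of an arbitrary real constant. -}

module Defs where

open import Data.Bool using (Bool; true; false; not; if_then_else_; _xor_; _∧_)
open import Data.Nat using (ℕ; zero; suc; _⊔_; _≤_)
open import Data.Fin using (Fin)
open import Data.Vec using (Vec; []; _∷_; lookup; zipWith; _[_]%=_)
open import Data.List using (List; []; _∷_; _++_; map; foldr; filter; length; allFin)
open import Data.Product using (Σ; _×_; ∃; ∃-syntax)
open import Data.Rational using (ℚ; 0ℚ; 1ℚ; _+_; _*_)
import Data.Rational as ℚ
open import Relation.Binary.PropositionalEquality using (_≡_; _≢_)
open import Relation.Nullary using (¬_; yes; no; Dec; ¬?)
open import Relation.Nullary.Decidable using (⌊_⌋)

BoolFun : ℕ → Set
BoolFun n = Vec Bool n → Bool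

Subset : ℕ → Set
Subset n = Vec Bool n

allVecs : (n : ℕ) → List (Vec Bool n)
allVecs zero    = [] ∷ []
allVecs (suc n) = map (false ∷_) (allVecs n) ++ map (true ∷_) (allVecs n)

card : ∀ {n} → Subset n → ℕ
card []          = 0
card (true ∷ s)  = suc (card s)
card (false ∷ s) = card s

nonEmpty : ∀ {n} → Subset n → Bool
nonEmpty []          = false
nonEmpty (true ∷ s)  = true
nonEmpty (false ∷ s) = nonEmpty s

maxList : List ℕ → ℕ
maxList = foldr _⊔_ 0

sumℚ : List ℚ → ℚ
sumℚ = foldr _+_ 0ℚ

-- Multilinear polynomials over ℚ (coefficient of each monomial ∏_{i∈S} x_i)

Coeffs : ℕ → Set
Coeffs n = Subset n → ℚ

monomial : ∀ {n} → Subset n → Vec Bool n → ℚ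
monomial []          []      = 1ℚ
monomial (true ∷ s)  (b ∷ x) = if b then monomial s x else 0ℚ
monomial (false ∷ s) (b ∷ x) = monomial s x

evalML : ∀ {n} → Coeffs n → Vec Bool n → ℚ
evalML {n} c x = sumℚ (map (λ S → c S * monomial S x) (allVecs n))

boolToℚ : Bool → ℚ
boolToℚ true  = 1ℚ
boolToℚ false = 0ℚ

-- c is the (unique) multilinear representation of f
IsMultilinearRep : ∀ {n} → BoolFun n → Coeffs n → Set
IsMultilinearRep f c = ∀ x → evalML c x ≡ boolToℚ (f x)

nonZeroCoeff : ∀ {n} → Coeffs n → Subset n → Bool
nonZeroCoeff c S = not ⌊ c S ℚ.≟ 0ℚ ⌋

spar : ∀ {n} → Coeffs n → ℕ
spar {n} c = length (filter (λ S → nonEmpty S ∧ nonZeroCoeff c S Data.Bool.≟ true) (allVecs n))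
  where import Data.Bool

-- deg = max{|S| : α_S ≠ 0}  (0 if all coefficients vanish)
deg : ∀ {n} → Coeffs n → ℕ
deg {n} c = maxList (map card (filter (λ S → nonZeroCoeff c S Data.Bool.≟ true) (allVecs n)))
  where import Data.Bool

flipBit : ∀ {n} → Fin n → Vec Bool n → Vec Bool n
flipBit i x = x [ i ]%= not

sensAt : ∀ {n} → BoolFun n → Vec Bool n → ℕ
sensAt {n} f x = length (filter (λ i → ¬? (f (flipBit i x) Data.Bool.≟ f x)) (allFin n))
  where import Data.Bool

sens : ∀ {n} → BoolFun n → ℕ
sens {n} f = maxList (map (sensAt f) (allVecs n))

flipBlock : ∀ {n} → Subset n → Vec Bool n → Vec Bool n
flipBlock B x = zipWith _xor_ x B

IsMonotoneSensitiveBlock : ∀ {n} → BoolFun n → Vec Bool n → Subset n → Set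
IsMonotoneSensitiveBlock f x B =
  (∃[ i ] lookup B i ≡ true)
  × (∀ i → lookup B i ≡ true → lookup x i ≡ false)
  × (f (flipBlock B x) ≢ f x)

DisjointMonotoneBlocks : ∀ {n} → BoolFun n → Vec Bool n → ℕ → Set
DisjointMonotoneBlocks {n} f x k =
  Σ (Fin k → Subset n) λ B →
    (∀ j → IsMonotoneSensitiveBlock f x (B j))
    × (∀ j j′ → j ≢ j′ → ∀ i → ¬ (lookup (B j) i ≡ true × lookup (B j′) i ≡ true))

IsMbsAt : ∀ {n} → BoolFun n → Vec Bool n → ℕ → Set
IsMbsAt f x m = DisjointMonotoneBlocks f x m × (∀ k → DisjointMonotoneBlocks f x k → k ≤ m)

IsMbs : ∀ {n} → BoolFun n → ℕ → Set
IsMbs f m = (∃[ x ] IsMbsAt f x m) × (∀ x k → IsMbsAt f x k → k ≤ m)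

{-# OPTIONS --safe #-}
-- Let f have degree d and sensitivity s at x. Restricting f to the s sensitive coordinates of x and
-- translating x to the origin gives g of degree at most d on s variables with g(0) = 0 and g(eᵢ) = 1.
-- Both properties survive composition, so the k-fold iterate of g on s ^ k variables has
-- mbs = s ^ k, while its degree is at most d ^ k and so its sparsity at most
-- (s ^ k + 1) ^ (d ^ k + 1). The hypothesis yields s ^ (k q) ≤ C (2 (s + 1) (k + 1) d ^ k) ^ p for
-- all k, and letting k grow forces s ^ q ≤ d ^ p, for (k + 1) ^ p is only polynomial in k.
module Submission where

open import Defs
open import Data.Bool using (Bool; true; false; not; _xor_; _∧_)
import Data.Bool as Bool
open import Data.Bool.Properties using (xor-identityʳ; xor-same)
open import Data.Fin using (Fin; zero; suc; _≟_; combine)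
open import Data.Fin.Properties using (any?; combine-injectiveʳ; combine-injectiveˡ; combine-surjective; injective⇒≤)
open import Data.List using (List; []; _∷_; _++_; map; filter; length; allFin)
import Data.List as List
open import Data.List.Membership.Propositional using (_∈_)
open import Data.List.Membership.Propositional.Properties using (∈-map⁺; ∈-++⁺ˡ; ∈-++⁺ʳ; ∈-filter⁺; ∈-filter⁻; ∈-lookup)
open import Data.List.Properties using (map-++; map-∘; length-++; filter-none; length-filter; filter-++)
import Data.List.Relation.Unary.All as All
open import Data.List.Relation.Unary.AllPairs using (_∷_)
open import Data.List.Relation.Unary.Any using (here; there)
open import Data.List.Relation.Unary.Unique.Propositional using (Unique)
open import Data.List.Relation.Unary.Unique.Propositional.Properties using (allFin⁺; filter⁺)
open import Data.Nat using (ℕ; zero; suc; pred; z≤n; s≤s; _+_; _*_; _^_; _⊔_; _≤_; _<_; _≤?_; NonZero; >-nonZero)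
open import Data.Nat.Logarithm using (⌈log₂_⌉; ⌈log₂⌉-mono-≤; ⌈log₂2^n⌉≡n)
open import Data.Nat.Properties as ℕₚ using (≤-refl; ≤-trans)
open import Data.Nat.Tactic.RingSolver using (solve-∀)
open import Data.Product using (_×_; _,_; proj₁; proj₂; ∃-syntax)
open import Data.Rational as ℚ using (ℚ; 0ℚ; 1ℚ)
import Data.Rational.Properties as ℚₚ
open import Data.Rational.Solver using (module +-*-Solver)
open import Data.Sum using (inj₁; inj₂)
open import Data.Unit using (⊤; tt)
open import Data.Vec using (Vec; []; _∷_; lookup; tabulate)
open import Data.Vec.Properties using (lookup∘tabulate; tabulate∘lookup; tabulate-cong; lookup∘updateAt; lookup∘updateAt′)
open import Function using (_∘_; mk⇔)
open import Function.Definitions using (Injective)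
open import Level using (0ℓ)
open import Relation.Binary.PropositionalEquality
open import Relation.Nullary using (¬_; ¬?; Dec; does; yes; no; contradiction)
open import Relation.Nullary.Decidable using (dec-true; dec-false; does-⇔)
open import Relation.Unary using (Pred; Decidable)
open +-*-Solver using (_:=_; _:+_; _:*_; _:-_)

-- Degree of functions on the cube

RealFun : ℕ → Set
RealFun n = Vec Bool n → ℚ

at₀ at₁ ∂ : ∀ {n} → RealFun (suc n) → RealFun n
at₀ F x = F (false ∷ x)
at₁ F x = F (true ∷ x)
∂ F x = at₁ F x ℚ.- at₀ F x

_⊕_ _⊗_ : ∀ {n} → RealFun n → RealFun n → RealFun n
(F ⊕ G) x = F x ℚ.+ G x
(F ⊗ G) x = F x ℚ.* G x

-- Degree less than d of the multilinear representation; ∂ strips the variable it differentiates.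
Deg< : ∀ {n} → ℕ → RealFun n → Set
Deg< zero F = ∀ x → F x ≡ 0ℚ
Deg< {zero} (suc d) F = ⊤
Deg< {suc n} (suc d) F = Deg< (suc d) (at₀ F) × Deg< d (∂ F)

Deg≤ : ∀ {n} → ℕ → RealFun n → Set
Deg≤ d = Deg< (suc d)

Deg<-resp-≗ : ∀ {n} d {F G : RealFun n} → F ≗ G → Deg< d F → Deg< d G
Deg<-resp-≗ zero eq F≡0 x = trans (sym (eq x)) (F≡0 x)
Deg<-resp-≗ {zero} (suc d) eq _ = tt
Deg<-resp-≗ {suc n} (suc d) eq (p , q) =
  Deg<-resp-≗ (suc d) (eq ∘ (false ∷_)) p ,
  Deg<-resp-≗ d (λ x → cong₂ ℚ._-_ (eq (true ∷ x)) (eq (false ∷ x))) q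

Deg<-zero : ∀ {n} d {F : RealFun n} → (∀ x → F x ≡ 0ℚ) → Deg< d F
Deg<-zero zero F≡0 = F≡0
Deg<-zero {zero} (suc d) F≡0 = tt
Deg<-zero {suc n} (suc d) F≡0 =
  Deg<-zero (suc d) (F≡0 ∘ (false ∷_)) ,
  Deg<-zero d (λ x → cong₂ ℚ._-_ (F≡0 (true ∷ x)) (F≡0 (false ∷ x)))

Deg<-suc : ∀ {n} d {F : RealFun n} → Deg< d F → Deg< (suc d) F
Deg<-suc zero F≡0 = Deg<-zero 1 F≡0
Deg<-suc {zero} (suc d) _ = tt
Deg<-suc {suc n} (suc d) (p , q) = Deg<-suc (suc d) p , Deg<-suc d q

Deg≤-const : ∀ {n} d (r : ℚ) → Deg≤ {n} d (λ _ → r)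
Deg≤-const {zero} d r = tt
Deg≤-const {suc n} d r = Deg≤-const d r , Deg<-zero d (λ _ → ℚₚ.+-inverseʳ r)

Deg<-⊕ : ∀ {n} d {F G : RealFun n} → Deg< d F → Deg< d G → Deg< d (F ⊕ G)
Deg<-⊕ zero F≡0 G≡0 x = cong₂ ℚ._+_ (F≡0 x) (G≡0 x)
Deg<-⊕ {zero} (suc d) _ _ = tt
Deg<-⊕ {suc n} (suc d) {F} {G} (p , q) (p′ , q′) =
  Deg<-⊕ (suc d) p p′ , Deg<-resp-≗ d ∂-⊕ (Deg<-⊕ d q q′)
  where
  ∂-⊕ : ∂ F ⊕ ∂ G ≗ ∂ (F ⊕ G)
  ∂-⊕ x = +-*-Solver.solve 4 (λ a b c e → (a :- b) :+ (c :- e) := (a :+ c) :- (b :+ e))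
    refl (F (true ∷ x)) (F (false ∷ x)) (G (true ∷ x)) (G (false ∷ x))

-- `at₁ F` is the sum of `at₀ F` and `∂ F`, the two functions that `Deg<` bounds.
Deg≤-at₁ : ∀ {n} d {F : RealFun (suc n)} → Deg≤ d F → Deg≤ d (at₁ F)
Deg≤-at₁ d {F} (p , q) = Deg<-resp-≗ (suc d)
  (λ x → +-*-Solver.solve 2 (λ a b → b :+ (a :- b) := a) refl (F (true ∷ x)) (F (false ∷ x)))
  (Deg<-⊕ (suc d) p (Deg<-suc d q))

-- The product rule ∂(F G) = ∂F · G₁ + ∂G · F₀ lowers one degree in each summand.
mutual
  Deg≤-⊗ : ∀ {n} a b {F G : RealFun n} → Deg≤ a F → Deg≤ b G → Deg≤ (a + b) (F ⊗ G)
  Deg≤-⊗ {zero} a b _ _ = tt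
  Deg≤-⊗ {suc n} a b {F} {G} (p , q) (p′ , q′) =
    Deg≤-⊗ a b p p′ ,
    Deg<-resp-≗ (a + b) leibniz
      (Deg<-⊕ (a + b)
        (Deg<-⊗ a b q (Deg≤-at₁ b {G} (p′ , q′)))
        (subst (λ e → Deg< e (∂ G ⊗ at₀ F)) (ℕₚ.+-comm b a) (Deg<-⊗ b a q′ p)))
    where
    leibniz : (∂ F ⊗ at₁ G) ⊕ (∂ G ⊗ at₀ F) ≗ ∂ (F ⊗ G)
    leibniz x = +-*-Solver.solve 4
      (λ a b c e → ((a :- b) :* c) :+ ((c :- e) :* b) := (a :* c) :- (b :* e))
      refl (F (true ∷ x)) (F (false ∷ x)) (G (true ∷ x)) (G (false ∷ x))

  -- The strict bound on the first factor covers the derivative of a function of degree `0`: bound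
  -- `0` means vanishing, and the product vanishes with it.
  Deg<-⊗ : ∀ {n} a b {F G : RealFun n} → Deg< a F → Deg≤ b G → Deg< (a + b) (F ⊗ G)
  Deg<-⊗ zero b {F} {G} F≡0 _ = Deg<-zero b
    (λ x → trans (cong (ℚ._* G x) (F≡0 x)) (ℚₚ.*-zeroˡ (G x)))
  Deg<-⊗ (suc a) b p q = Deg≤-⊗ a b p q

⟦_⟧ : ∀ {n} → BoolFun n → RealFun n
⟦ f ⟧ x = boolToℚ (f x)

Deg≤-lookup : ∀ {n} (i : Fin n) → Deg≤ 1 ⟦ (λ x → lookup x i) ⟧
Deg≤-lookup zero    = Deg≤-const 1 0ℚ , Deg≤-const 0 1ℚ
Deg≤-lookup (suc i) = Deg≤-lookup i , Deg<-zero 1 (λ x → ℚₚ.+-inverseʳ (boolToℚ (lookup x i)))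

cons-split : ∀ {n} (F : RealFun (suc n)) b x → at₀ F x ℚ.+ boolToℚ b ℚ.* ∂ F x ≡ F (b ∷ x)
cons-split F true x = trans (cong (at₀ F x ℚ.+_) (ℚₚ.*-identityˡ (∂ F x)))
  (+-*-Solver.solve 2 (λ a b → b :+ (a :- b) := a) refl (F (true ∷ x)) (F (false ∷ x)))
cons-split F false x = trans (cong (at₀ F x ℚ.+_) (ℚₚ.*-zeroˡ (∂ F x))) (ℚₚ.+-identityʳ (at₀ F x))

-- By expansion in the first variable, `F (b ∷ y)` is `at₀ F y` plus `b` times `∂ F y`; since `∂ F`
-- has one degree less, the second summand has degree at most `e + (d - 1) * e`. `F` is
-- rational-valued because `∂ F` need not be Boolean.
Deg≤-substitute : ∀ {n s} d e {F : RealFun s} {g : Fin s → BoolFun n} →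
  Deg≤ d F → (∀ i → Deg≤ e ⟦ g i ⟧) → Deg≤ (d * e) (λ x → F (tabulate (λ i → g i x)))
Deg≤-substitute {s = zero} d e {F} _ _ = Deg≤-const (d * e) (F [])
-- For `d = 0`, `q` says that `∂ F` vanishes, so `F` ignores its first input and the induction runs
-- through `at₀ F` alone.
Deg≤-substitute {s = suc s} zero e {F} {g} (p , q) r = Deg<-resp-≗ 1
  (λ x → let y = tabulate (λ i → g (suc i) x) in begin
    at₀ F y                                 ≡⟨ sym (ℚₚ.+-identityʳ (at₀ F y)) ⟩
    at₀ F y ℚ.+ 0ℚ                          ≡⟨ cong (at₀ F y ℚ.+_) (sym (ℚₚ.*-zeroʳ (⟦ g zero ⟧ x))) ⟩
    at₀ F y ℚ.+ ⟦ g zero ⟧ x ℚ.* 0ℚ         ≡⟨ cong (λ z → at₀ F y ℚ.+ ⟦ g zero ⟧ x ℚ.* z) (sym (q y)) ⟩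
    at₀ F y ℚ.+ ⟦ g zero ⟧ x ℚ.* ∂ F y      ≡⟨ cons-split F (g zero x) y ⟩
    F (g zero x ∷ y)                        ∎)
  (Deg≤-substitute zero e p (r ∘ suc))
  where open ≡-Reasoning
Deg≤-substitute {s = suc s} (suc d) e {F} {g} (p , q) r = Deg<-resp-≗ (suc (suc d * e))
  (λ x → cons-split F (g zero x) (tabulate (λ i → g (suc i) x)))
  (Deg<-⊕ (suc (suc d * e))
    (Deg≤-substitute (suc d) e p (r ∘ suc))
    (Deg≤-⊗ e (d * e) (r zero) (Deg≤-substitute d e q (r ∘ suc))))

-- Every function of one bit is affine in it, so this is substitution at `d = 1`.
Deg≤-unary : ∀ {n} e (u : Bool → Bool) {g : BoolFun n} → Deg≤ e ⟦ g ⟧ → Deg≤ e ⟦ u ∘ g ⟧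
Deg≤-unary e u {g} p = subst (λ k → Deg≤ k ⟦ u ∘ g ⟧) (ℕₚ.*-identityˡ e)
  (Deg≤-substitute 1 e {λ y → boolToℚ (u (lookup y zero))} {λ _ → g} (tt , tt) (λ _ → p))

-- Multilinear representations and finite differences

sumℚ-++ : ∀ xs ys → sumℚ (xs ++ ys) ≡ sumℚ xs ℚ.+ sumℚ ys
sumℚ-++ [] ys = sym (ℚₚ.+-identityˡ (sumℚ ys))
sumℚ-++ (x ∷ xs) ys = trans (cong (x ℚ.+_) (sumℚ-++ xs ys)) (sym (ℚₚ.+-assoc x (sumℚ xs) (sumℚ ys)))

sumℚ-zero : ∀ {A : Set} {h : A → ℚ} → (∀ a → h a ≡ 0ℚ) → ∀ xs → sumℚ (map h xs) ≡ 0ℚ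
sumℚ-zero h≡0 [] = refl
sumℚ-zero h≡0 (x ∷ xs) = cong₂ ℚ._+_ (h≡0 x) (sumℚ-zero h≡0 xs)

evalML-zero : ∀ {n} {c : Coeffs n} → (∀ S → c S ≡ 0ℚ) → ∀ x → evalML c x ≡ 0ℚ
evalML-zero {n} c≡0 x = sumℚ-zero
  (λ S → trans (cong (ℚ._* monomial S x) (c≡0 S)) (ℚₚ.*-zeroˡ (monomial S x))) (allVecs n)

evalML-cons : ∀ {n} (c : Coeffs (suc n)) b x →
  evalML c (b ∷ x) ≡ evalML (c ∘ (false ∷_)) x ℚ.+ boolToℚ b ℚ.* evalML (c ∘ (true ∷_)) x
evalML-cons {n} c b x = begin
  sumℚ (map term (map (false ∷_) V ++ map (true ∷_) V))
    ≡⟨ cong sumℚ (map-++ term (map (false ∷_) V) (map (true ∷_) V)) ⟩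
  sumℚ (map term (map (false ∷_) V) ++ map term (map (true ∷_) V))
    ≡⟨ sumℚ-++ (map term (map (false ∷_) V)) (map term (map (true ∷_) V)) ⟩
  sumℚ (map term (map (false ∷_) V)) ℚ.+ sumℚ (map term (map (true ∷_) V))
    ≡⟨ cong₂ (λ L M → sumℚ L ℚ.+ sumℚ M) (sym (map-∘ V)) (sym (map-∘ V)) ⟩
  evalML (c ∘ (false ∷_)) x ℚ.+ sumℚ (map (term ∘ (true ∷_)) V)
    ≡⟨ cong (evalML (c ∘ (false ∷_)) x ℚ.+_) (upper b) ⟩
  evalML (c ∘ (false ∷_)) x ℚ.+ boolToℚ b ℚ.* evalML (c ∘ (true ∷_)) x ∎
  where
  open ≡-Reasoning
  V = allVecs n
  term : Subset (suc n) → ℚ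
  term S = c S ℚ.* monomial S (b ∷ x)
  upper : ∀ b → sumℚ (map (λ S → c (true ∷ S) ℚ.* monomial (true ∷ S) (b ∷ x)) V) ≡
                boolToℚ b ℚ.* evalML (c ∘ (true ∷_)) x
  upper true  = sym (ℚₚ.*-identityˡ _)
  upper false = trans (sumℚ-zero (λ S → ℚₚ.*-zeroʳ (c (true ∷ S))) V) (sym (ℚₚ.*-zeroˡ (evalML (c ∘ (true ∷_)) x)))

-- The coefficients of `at₀` and `∂` of the polynomial are the two halves of `c`, and a set
-- containing the first variable loses one element on passing to `∂`.
Deg<-evalML : ∀ {n} d (c : Coeffs n) → (∀ S → d ≤ card S → c S ≡ 0ℚ) → Deg< d (evalML c)
Deg<-evalML zero c h = evalML-zero (λ S → h S z≤n)
Deg<-evalML {zero} (suc d) c h = tt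
Deg<-evalML {suc n} (suc d) c h =
  Deg<-resp-≗ (suc d) (λ x → sym (low x)) (Deg<-evalML (suc d) c₀ (h ∘ (false ∷_))) ,
  Deg<-resp-≗ d (λ x → sym (high x)) (Deg<-evalML d c₁ (λ S d≤S → h (true ∷ S) (s≤s d≤S)))
  where
  open ≡-Reasoning
  c₀ = c ∘ (false ∷_)
  c₁ = c ∘ (true ∷_)
  low : at₀ (evalML c) ≗ evalML c₀
  low x = begin
    evalML c (false ∷ x)                ≡⟨ evalML-cons c false x ⟩
    evalML c₀ x ℚ.+ 0ℚ ℚ.* evalML c₁ x  ≡⟨ cong (evalML c₀ x ℚ.+_) (ℚₚ.*-zeroˡ (evalML c₁ x)) ⟩
    evalML c₀ x ℚ.+ 0ℚ                  ≡⟨ ℚₚ.+-identityʳ (evalML c₀ x) ⟩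
    evalML c₀ x                         ∎
  high : ∂ (evalML c) ≗ evalML c₁
  high x = begin
    evalML c (true ∷ x) ℚ.- evalML c (false ∷ x)
      ≡⟨ cong₂ ℚ._-_ (evalML-cons c true x) (low x) ⟩
    (evalML c₀ x ℚ.+ 1ℚ ℚ.* evalML c₁ x) ℚ.- evalML c₀ x
      ≡⟨ cong (λ z → (evalML c₀ x ℚ.+ z) ℚ.- evalML c₀ x) (ℚₚ.*-identityˡ (evalML c₁ x)) ⟩
    (evalML c₀ x ℚ.+ evalML c₁ x) ℚ.- evalML c₀ x
      ≡⟨ +-*-Solver.solve 2 (λ a b → (a :+ b) :- a := b) refl (evalML c₀ x) (evalML c₁ x) ⟩
    evalML c₁ x ∎

-- Möbius inversion in recursive form: the coefficient of `S` is the iterated difference of `F` in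
-- the directions of `S`, taken at the origin.
coeffs : ∀ {n} → RealFun n → Coeffs n
coeffs F [] = F []
coeffs F (false ∷ S) = coeffs (at₀ F) S
coeffs F (true ∷ S) = coeffs (∂ F) S

evalML-coeffs : ∀ {n} (F : RealFun n) → evalML (coeffs F) ≗ F
evalML-coeffs F [] = trans (ℚₚ.+-identityʳ (F [] ℚ.* 1ℚ)) (ℚₚ.*-identityʳ (F []))
evalML-coeffs F (b ∷ x) = begin
  evalML (coeffs F) (b ∷ x)
    ≡⟨ evalML-cons (coeffs F) b x ⟩
  evalML (coeffs (at₀ F)) x ℚ.+ boolToℚ b ℚ.* evalML (coeffs (∂ F)) x
    ≡⟨ cong₂ (λ y z → y ℚ.+ boolToℚ b ℚ.* z) (evalML-coeffs (at₀ F) x) (evalML-coeffs (∂ F) x) ⟩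
  at₀ F x ℚ.+ boolToℚ b ℚ.* ∂ F x
    ≡⟨ cons-split F b x ⟩
  F (b ∷ x) ∎
  where open ≡-Reasoning

coeffs-zero : ∀ {n} {F : RealFun n} → (∀ x → F x ≡ 0ℚ) → ∀ S → coeffs F S ≡ 0ℚ
coeffs-zero F≡0 [] = F≡0 []
coeffs-zero F≡0 (false ∷ S) = coeffs-zero (F≡0 ∘ (false ∷_)) S
coeffs-zero F≡0 (true ∷ S) =
  coeffs-zero (λ x → cong₂ ℚ._-_ (F≡0 (true ∷ x)) (F≡0 (false ∷ x))) S

length-filter-map : ∀ {A B : Set} {P : Pred B 0ℓ} (P? : Decidable P) (h : A → B) xs →
  length (filter P? (map h xs)) ≡ length (filter (P? ∘ h) xs)
length-filter-map P? h [] = refl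
length-filter-map P? h (x ∷ xs) with P? (h x)
... | yes _ = cong suc (length-filter-map P? h xs)
... | no  _ = length-filter-map P? h xs

-- A crude count of the sets with fewer than `d` elements, by Pascal's recursion on the first
-- variable. The predicate is arbitrary so that it can be pulled back along `false ∷_` and
-- `true ∷_`.
count-coeffs : ∀ {n} d {F : RealFun n} → Deg< d F →
  {P : Pred (Subset n) 0ℓ} (P? : Decidable P) → (∀ S → P S → coeffs F S ≢ 0ℚ) →
  length (filter P? (allVecs n)) ≤ suc n ^ d
count-coeffs {n} zero F≡0 P? nz = subst (λ L → length L ≤ 1)
  (sym (filter-none P? (All.universal (λ S PS → nz S PS (coeffs-zero F≡0 S)) (allVecs n)))) z≤n
count-coeffs {zero} (suc d) _ P? nz =
  ≤-trans (length-filter P? (allVecs 0)) (ℕₚ.m^n>0 1 (suc d))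
count-coeffs {suc n} (suc d) (p , q) P? nz = begin
  length (filter P? (map (false ∷_) V ++ map (true ∷_) V))
    ≡⟨ cong length (filter-++ P? (map (false ∷_) V) (map (true ∷_) V)) ⟩
  length (filter P? (map (false ∷_) V) ++ filter P? (map (true ∷_) V))
    ≡⟨ length-++ (filter P? (map (false ∷_) V)) ⟩
  length (filter P? (map (false ∷_) V)) + length (filter P? (map (true ∷_) V))
    ≡⟨ cong₂ _+_ (length-filter-map P? (false ∷_) V) (length-filter-map P? (true ∷_) V) ⟩
  length (filter (P? ∘ (false ∷_)) V) + length (filter (P? ∘ (true ∷_)) V)
    ≤⟨ ℕₚ.+-mono-≤ (count-coeffs (suc d) p (P? ∘ (false ∷_)) (nz ∘ (false ∷_)))
                   (count-coeffs d q (P? ∘ (true ∷_)) (nz ∘ (true ∷_))) ⟩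
  suc n * suc n ^ d + suc n ^ d
    ≡⟨ ℕₚ.+-comm (suc n * suc n ^ d) (suc n ^ d) ⟩
  suc (suc n) * suc n ^ d
    ≤⟨ ℕₚ.*-monoʳ-≤ (suc (suc n)) (ℕₚ.^-monoˡ-≤ d (ℕₚ.n≤1+n (suc n))) ⟩
  suc (suc n) * suc (suc n) ^ d ∎
  where
  open ℕₚ.≤-Reasoning
  V = allVecs n

-- Composition and monotone block sensitivity

zeros : ∀ {n} → Vec Bool n
zeros = tabulate (λ _ → false)

unit : ∀ {n} → Fin n → Vec Bool n
unit i = tabulate (λ j → does (i ≟ j))

lookup-zeros : ∀ {n} (i : Fin n) → lookup zeros i ≡ false
lookup-zeros = lookup∘tabulate (λ _ → false)

lookup-unit : ∀ {n} (i j : Fin n) → lookup (unit i) j ≡ does (i ≟ j)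
lookup-unit i = lookup∘tabulate (λ j → does (i ≟ j))

does-true⁻ : ∀ {A : Set} (a? : Dec A) → does a? ≡ true → A
does-true⁻ (yes a) _ = a

lookup-unit⁻ : ∀ {n} (i j : Fin n) → lookup (unit i) j ≡ true → i ≡ j
lookup-unit⁻ i j eq = does-true⁻ (i ≟ j) (trans (sym (lookup-unit i j)) eq)

SensitiveToUnits : ∀ {n} → BoolFun n → Set
SensitiveToUnits f = f zeros ≡ false × (∀ i → f (unit i) ≡ true)

-- Picking one element from each block is injective by disjointness.
blocks≤n : ∀ {n k} (f : BoolFun n) x → DisjointMonotoneBlocks f x k → k ≤ n
blocks≤n {n} {k} f x (B , sensitive , disjoint) = injective⇒≤ {f = pick} pick-injective
  where
  pick : Fin k → Fin n
  pick j = proj₁ (proj₁ (sensitive j))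
  pick∈ : ∀ j → lookup (B j) (pick j) ≡ true
  pick∈ j = proj₂ (proj₁ (sensitive j))
  pick-injective : Injective _≡_ _≡_ pick
  pick-injective {j} {j′} eq with j ≟ j′
  ... | yes j≡j′ = j≡j′
  ... | no  j≢j′ = contradiction
    (pick∈ j , trans (cong (lookup (B j′)) eq) (pick∈ j′)) (disjoint j j′ j≢j′ (pick j))

flipBlock-zeros : ∀ {n} (B : Subset n) → flipBlock B zeros ≡ B
flipBlock-zeros [] = refl
flipBlock-zeros (b ∷ B) = cong (b ∷_) (flipBlock-zeros B)

mbs-sensitiveToUnits : ∀ {n} {f : BoolFun n} → SensitiveToUnits f → IsMbs f n
mbs-sensitiveToUnits {n} {f} (f0 , f1) =
  (zeros , (unit , block , disjoint) , λ _ → blocks≤n f zeros) , λ x _ → blocks≤n f x ∘ proj₁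
  where
  block : ∀ j → IsMonotoneSensitiveBlock f zeros (unit j)
  block j =
    (j , trans (lookup-unit j j) (dec-true (j ≟ j) refl)) ,
    (λ i _ → lookup-zeros i) ,
    λ eq → contradiction
      (trans (sym (f1 j)) (trans (cong f (sym (flipBlock-zeros (unit j)))) (trans eq f0))) λ ()
  disjoint : ∀ j j′ → j ≢ j′ → ∀ i → ¬ (lookup (unit j) i ≡ true × lookup (unit j′) i ≡ true)
  disjoint j j′ j≢j′ i (p , q) = j≢j′ (trans (lookup-unit⁻ j i p) (sym (lookup-unit⁻ j′ i q)))

-- `combine i j` indexes variable `j` of copy `i`, so distinct slices read disjoint groups of
-- variables.
slice : ∀ {s n} → Vec Bool (s * n) → Fin s → Vec Bool n
slice x i = tabulate (λ j → lookup x (combine i j))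

slice-zeros : ∀ {s n} (i : Fin s) → slice {s} {n} zeros i ≡ zeros
slice-zeros i = tabulate-cong (λ j → lookup-zeros (combine i j))

slice-unit-≡ : ∀ {s n} (i : Fin s) (j : Fin n) → slice (unit (combine i j)) i ≡ unit j
slice-unit-≡ i j = tabulate-cong (λ j′ → trans (lookup-unit (combine i j) (combine i j′))
  (does-⇔ (mk⇔ (combine-injectiveʳ i j i j′) (cong (combine i)))
    (combine i j ≟ combine i j′) (j ≟ j′)))

slice-unit-≢ : ∀ {s n} {i i′ : Fin s} (j : Fin n) → i ≢ i′ → slice (unit (combine i j)) i′ ≡ zeros
slice-unit-≢ {i = i} {i′} j i≢i′ = tabulate-cong (λ j′ →
  trans (lookup-unit (combine i j) (combine i′ j′))
    (dec-false (combine i j ≟ combine i′ j′) (i≢i′ ∘ combine-injectiveˡ i j i′ j′)))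

_⊙_ : ∀ {s n} → BoolFun s → BoolFun n → BoolFun (s * n)
(g ⊙ h) x = g (tabulate (λ i → h (slice x i)))

-- In the unit vector at `combine i j`, slice `i` is a unit vector and every other slice is zero, so
-- `g` receives `unit i`.
⊙-sensitiveToUnits : ∀ {s n} (g : BoolFun s) (h : BoolFun n) →
  SensitiveToUnits g → SensitiveToUnits h → SensitiveToUnits (g ⊙ h)
⊙-sensitiveToUnits {s} {n} g h (g0 , g1) (h0 , h1) =
  trans (cong g (tabulate-cong (λ i → trans (cong h (slice-zeros i)) h0))) g0 , at-unit
  where
  at-unit : ∀ i → (g ⊙ h) (unit i) ≡ true
  at-unit ij with i , j , refl ← combine-surjective {s} {n} ij =
    trans (cong g (tabulate-cong inner)) (g1 i)
    where
    inner : ∀ i′ → h (slice (unit (combine i j)) i′) ≡ does (i ≟ i′)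
    inner i′ with i ≟ i′
    ... | yes refl = trans (cong h (slice-unit-≡ i j)) (h1 j)
    ... | no  i≢i′ = trans (cong h (slice-unit-≢ j i≢i′)) h0

-- Slicing substitutes single variables into `h` and keeps its bound `e`; substituting the copies of
-- `h` into `g` multiplies the bounds.
⊙-Deg≤ : ∀ {s n} d e (g : BoolFun s) (h : BoolFun n) →
  Deg≤ d ⟦ g ⟧ → Deg≤ e ⟦ h ⟧ → Deg≤ (d * e) ⟦ g ⊙ h ⟧
⊙-Deg≤ d e g h p q = Deg≤-substitute d e p (λ i →
  subst (λ k → Deg≤ k ⟦ (λ x → h (slice x i)) ⟧) (ℕₚ.*-identityʳ e)
    (Deg≤-substitute e 1 q (λ j → Deg≤-lookup (combine i j))))

iterate : ∀ {s} → BoolFun s → ∀ k → BoolFun (s ^ k)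
iterate g zero    x = lookup x zero
iterate g (suc k) = g ⊙ iterate g k

iterate-sensitiveToUnits : ∀ {s} (g : BoolFun s) → SensitiveToUnits g →
  ∀ k → SensitiveToUnits (iterate g k)
iterate-sensitiveToUnits g sens-g zero = refl , λ { zero → refl }
iterate-sensitiveToUnits g sens-g (suc k) =
  ⊙-sensitiveToUnits g (iterate g k) sens-g (iterate-sensitiveToUnits g sens-g k)

iterate-Deg≤ : ∀ {s} d (g : BoolFun s) → Deg≤ d ⟦ g ⟧ → ∀ k → Deg≤ (d ^ k) ⟦ iterate g k ⟧
iterate-Deg≤ d g p zero = Deg≤-lookup {1} zero
iterate-Deg≤ d g p (suc k) = ⊙-Deg≤ d (d ^ k) g (iterate g k) p (iterate-Deg≤ d g p k)

-- Restriction to sensitive coordinates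

module _ {n s} (f : BoolFun n) (x : Vec Bool n) (ι : Fin s → Fin n) where

  -- The flip to apply at coordinate `i`: the variable of a preimage of `i` under `ι`, or no flip
  -- outside the image.
  select : Fin n → BoolFun s
  select i y with any? (λ j → ι j ≟ i)
  ... | yes (j , _) = lookup y j
  ... | no  _       = false

  embed : Vec Bool s → Vec Bool n
  embed y = tabulate (λ i → lookup x i xor select i y)

  -- The outer xor complements `f` when `f x` is `true`, which makes the value at the origin
  -- `false`.
  localise : BoolFun s
  localise y = f x xor f (embed y)

  select-Deg≤ : ∀ i → Deg≤ 1 ⟦ select i ⟧
  select-Deg≤ i with any? (λ j → ι j ≟ i)
  ... | yes (j , _) = Deg≤-lookup j
  ... | no  _       = Deg≤-const 1 _

  -- Each coordinate of `embed` depends on at most one variable, so it has degree at most `1` and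
  -- its substitution keeps the bound `d`.
  localise-Deg≤ : ∀ d → Deg≤ d ⟦ f ⟧ → Deg≤ d ⟦ localise ⟧
  localise-Deg≤ d p = Deg≤-unary d (f x xor_)
    (subst (λ k → Deg≤ k ⟦ (λ y → f (embed y)) ⟧) (ℕₚ.*-identityʳ d)
      (Deg≤-substitute d 1 p (λ i → Deg≤-unary 1 (lookup x i xor_) (select-Deg≤ i))))

  select-zeros : ∀ i → select i zeros ≡ false
  select-zeros i with any? (λ j → ι j ≟ i)
  ... | yes (j , _) = lookup-zeros j
  ... | no  _       = refl

  embed-zeros : embed zeros ≡ x
  embed-zeros = trans
    (tabulate-cong (λ i → trans (cong (lookup x i xor_) (select-zeros i)) (xor-identityʳ _)))
    (tabulate∘lookup x)

  select-unit : Injective _≡_ _≡_ ι → ∀ i j → select i (unit j) ≡ does (ι j ≟ i)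
  select-unit ι-inj i j with any? (λ j′ → ι j′ ≟ i)
  -- The search may return any preimage `j′`; injectivity of `ι` makes the tests `j ≟ j′` and
  -- `ι j ≟ ι j′` agree.
  ... | yes (j′ , refl) = trans (lookup-unit j j′)
    (does-⇔ (mk⇔ (cong ι) ι-inj) (j ≟ j′) (ι j ≟ ι j′))
  ... | no  ∄j = sym (dec-false (ι j ≟ i) (λ eq → ∄j (j , eq)))

  embed-unit : Injective _≡_ _≡_ ι → ∀ j → embed (unit j) ≡ flipBit (ι j) x
  embed-unit ι-inj j = trans (tabulate-cong pointwise) (tabulate∘lookup (flipBit (ι j) x))
    where
    xor-true : ∀ b → b xor true ≡ not b
    xor-true true  = refl
    xor-true false = refl
    pointwise : ∀ i → lookup x i xor select i (unit j) ≡ lookup (flipBit (ι j) x) i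
    pointwise i rewrite select-unit ι-inj i j with ι j ≟ i
    ... | yes refl = trans (xor-true _) (sym (lookup∘updateAt (ι j) x))
    ... | no  ιj≢i = trans (xor-identityʳ _)
      (sym (lookup∘updateAt′ i (ι j) (ιj≢i ∘ sym) x))

  localise-sensitiveToUnits : Injective _≡_ _≡_ ι → (∀ j → f (flipBit (ι j) x) ≢ f x) →
    SensitiveToUnits localise
  localise-sensitiveToUnits ι-inj sensitive =
    trans (cong (λ y → f x xor f y) embed-zeros) (xor-same (f x)) ,
    λ j → trans (cong (λ y → f x xor f y) (embed-unit ι-inj j)) (xor-≢ (sensitive j))
    where
    xor-≢ : ∀ {a b} → b ≢ a → a xor b ≡ true
    xor-≢ {true}  {true}  b≢a = contradiction refl b≢a
    xor-≢ {true}  {false} _   = refl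
    xor-≢ {false} {true}  _   = refl
    xor-≢ {false} {false} b≢a = contradiction refl b≢a

-- Growth of powers

^-distribʳ-* : ∀ p m n → (m * n) ^ p ≡ m ^ p * n ^ p
^-distribʳ-* zero m n = refl
^-distribʳ-* (suc p) m n = trans (cong (m * n *_) (^-distribʳ-* p m n)) (interchange m n (m ^ p) (n ^ p))
  where
  interchange : ∀ a b c d → (a * b) * (c * d) ≡ (a * c) * (b * d)
  interchange = solve-∀

^-comm : ∀ m n o → (m ^ n) ^ o ≡ (m ^ o) ^ n
^-comm m n o = trans (ℕₚ.^-*-assoc m n o)
  (trans (cong (m ^_) (ℕₚ.*-comm n o)) (sym (ℕₚ.^-*-assoc m o n)))

n<2^n : ∀ n → n < 2 ^ n
n<2^n zero = s≤s z≤n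
n<2^n (suc n) = ℕₚ.+-mono-≤ (ℕₚ.m^n>0 2 n) (≤-trans (n<2^n n) (ℕₚ.m≤m+n (2 ^ n) 0))

2^-cancel-≤ : ∀ {m n} → 2 ^ m ≤ 2 ^ n → m ≤ n
2^-cancel-≤ le = ℕₚ.≮⇒≥ (λ n<m → ℕₚ.<⇒≱ (ℕₚ.^-monoʳ-< 2 ≤-refl n<m) le)

-- Bernoulli's inequality `1 + k/a ≤ (1 + 1/a)^k`, multiplied by `a^(k+1)` to stay in the naturals.
bernoulli : ∀ a k → (a + k) * a ^ k ≤ a * suc a ^ k
bernoulli a zero = ℕₚ.≤-reflexive (cong (_* 1) (ℕₚ.+-identityʳ a))
bernoulli a (suc k) = begin
  (a + suc k) * (a * a ^ k)           ≤⟨ ℕₚ.m≤m+n _ (k * a ^ k) ⟩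
  (a + suc k) * (a * a ^ k) + k * a ^ k ≡⟨ regroup a k (a ^ k) ⟩
  suc a * ((a + k) * a ^ k)           ≤⟨ ℕₚ.*-monoʳ-≤ (suc a) (bernoulli a k) ⟩
  suc a * (a * suc a ^ k)             ≡⟨ swap (suc a) a (suc a ^ k) ⟩
  a * (suc a * suc a ^ k)             ∎
  where
  open ℕₚ.≤-Reasoning
  regroup : ∀ a k x → (a + suc k) * (a * x) + k * x ≡ suc a * ((a + k) * x)
  regroup = solve-∀
  swap : ∀ a b c → a * (b * c) ≡ b * (a * c)
  swap = solve-∀

-- This is `bernoulli` at `k = a`: the power `a` turns the gap between `a` and `a + 1` into a factor
-- `2`.
2*a^a≤[1+a]^a : ∀ a .{{_ : NonZero a}} → 2 * a ^ a ≤ suc a ^ a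
2*a^a≤[1+a]^a a = ℕₚ.*-cancelˡ-≤ a (≤-trans (ℕₚ.≤-reflexive (double a (a ^ a))) (bernoulli a a))
  where
  double : ∀ a x → a * (2 * x) ≡ (a + a) * x
  double = solve-∀

-- With m = 2 ^ t - 1 the bound becomes 2 ^ t ≤ 2 * A + t * p, which fails at t = 2 * (2 * A + 2 * p).
2^-not-polynomial : ∀ A p → ¬ (∀ m → 2 ^ m ≤ A * suc m ^ p)
2^-not-polynomial A p bound = ℕₚ.<⇒≱ too-big (linear (u + u))
  where
  u = 2 * A + 2 * p
  open ℕₚ.≤-Reasoning
  suc-pred : ∀ t → suc (pred (2 ^ t)) ≡ 2 ^ t
  suc-pred t = ℕₚ.suc-pred (2 ^ t) {{ℕₚ.m^n≢0 2 t}}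
  linear : ∀ t → 2 ^ t ≤ 2 * A + t * p
  linear t = 2^-cancel-≤ (begin
    2 ^ (2 ^ t)                              ≡⟨ cong (2 ^_) (sym (suc-pred t)) ⟩
    2 * 2 ^ pred (2 ^ t)                     ≤⟨ ℕₚ.*-monoʳ-≤ 2 (bound (pred (2 ^ t))) ⟩
    2 * (A * suc (pred (2 ^ t)) ^ p)         ≡⟨ cong (λ z → 2 * (A * z ^ p)) (suc-pred t) ⟩
    2 * (A * (2 ^ t) ^ p)                    ≡⟨ sym (ℕₚ.*-assoc 2 A ((2 ^ t) ^ p)) ⟩
    2 * A * (2 ^ t) ^ p                      ≤⟨ ℕₚ.*-monoˡ-≤ ((2 ^ t) ^ p) (ℕₚ.<⇒≤ (n<2^n (2 * A))) ⟩
    2 ^ (2 * A) * (2 ^ t) ^ p                ≡⟨ cong (2 ^ (2 * A) *_) (ℕₚ.^-*-assoc 2 t p) ⟩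
    2 ^ (2 * A) * 2 ^ (t * p)                ≡⟨ sym (ℕₚ.^-distribˡ-+-* 2 (2 * A) (t * p)) ⟩
    2 ^ (2 * A + t * p)                      ∎)
  too-big : 2 * A + (u + u) * p < 2 ^ (u + u)
  too-big = begin-strict
    -- Since `u = 2 * A + 2 * p`, the added slack completes the left side to `(u + 1)^2 - 1`.
    2 * A + (u + u) * p                ≤⟨ ℕₚ.m≤m+n _ (2 * A * u + 2 * p + u) ⟩
    2 * A + (u + u) * p + (2 * A * u + 2 * p + u)
                                       ≡⟨ regroup A p u ⟩
    (2 * A + 2 * p) + u + u * (2 * A + 2 * p) ≡⟨⟩
    u + u + u * u                      <⟨ ≤-refl ⟩
    suc (u + u + u * u)                ≡⟨ square u ⟩
    suc u * suc u                      ≤⟨ ℕₚ.*-mono-≤ (n<2^n u) (n<2^n u) ⟩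
    2 ^ u * 2 ^ u                      ≡⟨ sym (ℕₚ.^-distribˡ-+-* 2 u u) ⟩
    2 ^ (u + u)                        ∎
    where
    regroup : ∀ A p u → 2 * A + (u + u) * p + (2 * A * u + 2 * p + u) ≡
              (2 * A + 2 * p) + u + u * (2 * A + 2 * p)
    regroup = solve-∀
    square : ∀ u → suc (u + u + u * u) ≡ suc u * suc u
    square = solve-∀

-- If `b` were at least `a + 1`, then at `k = a * m` the ratio of `b ^ k` to `a ^ k` would be at
-- least `2 ^ m`, while the bound allows only a polynomial in `m`.
^-bound⇒≤ : ∀ {a b A p} .{{_ : NonZero a}} → (∀ k → b ^ k ≤ A * suc k ^ p * a ^ k) → b ≤ a
^-bound⇒≤ {a} {b} {A} {p} bound with b ≤? a
... | yes b≤a = b≤a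
... | no  b≰a = contradiction doubling (2^-not-polynomial (A * suc a ^ p) p)
  where
  open ℕₚ.≤-Reasoning
  linear : ∀ a m → suc (a * m) + (a + m) ≡ suc a * suc m
  linear = solve-∀
  doubling : ∀ m → 2 ^ m ≤ A * suc a ^ p * suc m ^ p
  doubling m = ℕₚ.*-cancelʳ-≤ _ _ (a ^ (a * m)) {{ℕₚ.m^n≢0 a (a * m)}} (begin
    2 ^ m * a ^ (a * m)            ≡⟨ cong (2 ^ m *_) (sym (ℕₚ.^-*-assoc a a m)) ⟩
    2 ^ m * (a ^ a) ^ m            ≡⟨ sym (^-distribʳ-* m 2 (a ^ a)) ⟩
    (2 * a ^ a) ^ m                ≤⟨ ℕₚ.^-monoˡ-≤ m (2*a^a≤[1+a]^a a) ⟩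
    (suc a ^ a) ^ m                ≡⟨ ℕₚ.^-*-assoc (suc a) a m ⟩
    suc a ^ (a * m)                ≤⟨ ℕₚ.^-monoˡ-≤ (a * m) (ℕₚ.≰⇒> b≰a) ⟩
    b ^ (a * m)                    ≤⟨ bound (a * m) ⟩
    A * suc (a * m) ^ p * a ^ (a * m)
      -- `a * m + 1 ≤ (a + 1) * (m + 1)` separates the dependence on `a`, which joins the constant,
      -- from a power of `m + 1`.
      ≤⟨ ℕₚ.*-monoˡ-≤ (a ^ (a * m)) (ℕₚ.*-monoʳ-≤ A (ℕₚ.^-monoˡ-≤ p
           (≤-trans (ℕₚ.m≤m+n _ (a + m)) (ℕₚ.≤-reflexive (linear a m))))) ⟩
    A * (suc a * suc m) ^ p * a ^ (a * m)
      ≡⟨ cong (λ z → A * z * a ^ (a * m)) (^-distribʳ-* p (suc a) (suc m)) ⟩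
    A * (suc a ^ p * suc m ^ p) * a ^ (a * m)
      ≡⟨ cong (_* a ^ (a * m)) (sym (ℕₚ.*-assoc A (suc a ^ p) (suc m ^ p))) ⟩
    A * suc a ^ p * suc m ^ p * a ^ (a * m) ∎)

-- Sparsity, degree and sensitivity

∈-allVecs : ∀ {n} (x : Vec Bool n) → x ∈ allVecs n
∈-allVecs [] = here refl
∈-allVecs {suc n} (false ∷ x) = ∈-++⁺ˡ (∈-map⁺ (false ∷_) (∈-allVecs x))
∈-allVecs {suc n} (true ∷ x) = ∈-++⁺ʳ (map (false ∷_) (allVecs n)) (∈-map⁺ (true ∷_) (∈-allVecs x))

∈⇒≤maxList : ∀ {m ms} → m ∈ ms → m ≤ maxList ms
∈⇒≤maxList {ms = m ∷ ms} (here refl) = ℕₚ.m≤m⊔n m (maxList ms)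
∈⇒≤maxList {ms = m ∷ ms} (there m∈) = ≤-trans (∈⇒≤maxList m∈) (ℕₚ.m≤n⊔m m (maxList ms))

-- The maximum is attained by an entry or is the default `0` of the empty list, hence the hypothesis
-- `P 0`.
maxList-map-elim : ∀ {A : Set} (P : ℕ → Set) {h : A → ℕ} → P 0 → (∀ a → P (h a)) →
  ∀ xs → P (maxList (map h xs))
maxList-map-elim P p0 ph [] = p0
maxList-map-elim P {h} p0 ph (x ∷ xs) with ℕₚ.⊔-sel (h x) (maxList (map h xs))
... | inj₁ eq = subst P (sym eq) (ph x)
... | inj₂ eq = subst P (sym eq) (maxList-map-elim P p0 ph xs)

-- Serves to turn the duplicate-free list of sensitive coordinates into an injection `ι`.
lookup-injective : ∀ {A : Set} {xs : List A} → Unique xs → Injective _≡_ _≡_ (List.lookup xs)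
lookup-injective (x∉ ∷ u) {zero}  {zero}  eq = refl
lookup-injective {xs = _ ∷ xs} (x∉ ∷ u) {zero}  {suc j} eq = contradiction eq (All.lookup x∉ (∈-lookup j))
lookup-injective {xs = _ ∷ xs} (x∉ ∷ u) {suc i} {zero}  eq = contradiction (sym eq) (All.lookup x∉ (∈-lookup i))
lookup-injective (x∉ ∷ u) {suc i} {suc j} eq = cong suc (lookup-injective u eq)

nonZeroCoeff⁺ : ∀ {n} (c : Coeffs n) S → c S ≢ 0ℚ → nonZeroCoeff c S ≡ true
nonZeroCoeff⁺ c S cS≢0 with c S ℚ.≟ 0ℚ
... | yes cS≡0 = contradiction cS≡0 cS≢0
... | no  _    = refl

nonZeroCoeff⁻ : ∀ {n} (c : Coeffs n) S → nonZeroCoeff c S ≡ true → c S ≢ 0ℚ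
nonZeroCoeff⁻ c S eq with c S ℚ.≟ 0ℚ
nonZeroCoeff⁻ c S () | yes _
nonZeroCoeff⁻ c S eq | no cS≢0 = cS≢0

card≤deg : ∀ {n} (c : Coeffs n) S → c S ≢ 0ℚ → card S ≤ deg c
card≤deg c S cS≢0 = ∈⇒≤maxList (∈-map⁺ card
  (∈-filter⁺ (λ S → nonZeroCoeff c S Bool.≟ true) (∈-allVecs S) (nonZeroCoeff⁺ c S cS≢0)))

Deg≤-rep : ∀ {n d} (f : BoolFun n) (c : Coeffs n) → IsMultilinearRep f c → deg c ≤ d → Deg≤ d ⟦ f ⟧
Deg≤-rep {d = d} f c rep deg≤d = Deg<-resp-≗ (suc d) rep (Deg<-evalML (suc d) c vanish)
  where
  vanish : ∀ S → d < card S → c S ≡ 0ℚ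
  vanish S d<S with c S ℚ.≟ 0ℚ
  ... | yes cS≡0 = cS≡0
  ... | no  cS≢0 = contradiction (≤-trans (card≤deg c S cS≢0) deg≤d) (ℕₚ.<⇒≱ d<S)

spar-coeffs : ∀ {n d} {F : RealFun n} → Deg≤ d F → spar (coeffs F) ≤ suc n ^ suc d
spar-coeffs {n} {d} {F} p = count-coeffs (suc d) p
  (λ S → nonEmpty S ∧ nonZeroCoeff (coeffs F) S Bool.≟ true)
  (λ S eq → nonZeroCoeff⁻ (coeffs F) S (∧-true (nonEmpty S) eq))
  where
  ∧-true : ∀ a {b} → a ∧ b ≡ true → b ≡ true
  ∧-true true eq = eq

-- The base `s ^ k + 1` contributes only a factor linear in `k` to the logarithm; the exponential
-- growth comes from the exponent `d ^ k + 1`.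
log-spar-bound : ∀ s k d .{{_ : NonZero d}} {r} → r ≤ suc (s ^ k) ^ suc (d ^ k) →
  1 ⊔ ⌈log₂ r ⌉ ≤ 2 * suc s * suc k * d ^ k
log-spar-bound s k d {r} r≤ = ℕₚ.⊔-lub
  (ℕₚ.*-mono-≤ {1} {2 * suc s * suc k} (s≤s z≤n) d^k>0)
  (begin
    ⌈log₂ r ⌉                                    ≤⟨ ⌈log₂⌉-mono-≤ r≤ ⟩
    ⌈log₂ suc (s ^ k) ^ suc (d ^ k) ⌉            ≤⟨ ⌈log₂⌉-mono-≤ (ℕₚ.^-monoˡ-≤ (suc (d ^ k)) base) ⟩
    ⌈log₂ (2 ^ suc (s * k)) ^ suc (d ^ k) ⌉      ≡⟨ cong ⌈log₂_⌉ (ℕₚ.^-*-assoc 2 (suc (s * k)) (suc (d ^ k))) ⟩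
    ⌈log₂ 2 ^ (suc (s * k) * suc (d ^ k)) ⌉      ≡⟨ ⌈log₂2^n⌉≡n (suc (s * k) * suc (d ^ k)) ⟩
    -- Here `1 ≤ d ^ k` absorbs the added one into a second copy of `d ^ k`.
    suc (s * k) * suc (d ^ k)                    ≤⟨ ℕₚ.*-mono-≤
      (≤-trans (ℕₚ.m≤m+n (suc (s * k)) (s + k)) (ℕₚ.≤-reflexive (expand s k))) (ℕₚ.+-monoˡ-≤ (d ^ k) d^k>0) ⟩
    suc s * suc k * (d ^ k + d ^ k)              ≡⟨ regroup (suc s) (suc k) (d ^ k) ⟩
    2 * suc s * suc k * d ^ k                    ∎)
  where
  open ℕₚ.≤-Reasoning
  d^k>0 : 1 ≤ d ^ k
  d^k>0 = ℕₚ.m^n>0 d k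
  base : suc (s ^ k) ≤ 2 ^ suc (s * k)
  base = begin
    1 + s ^ k                  ≤⟨ ℕₚ.+-mono-≤ (ℕₚ.m^n>0 2 (s * k))
                                    (ℕₚ.^-monoˡ-≤ k (ℕₚ.<⇒≤ (n<2^n s))) ⟩
    2 ^ (s * k) + (2 ^ s) ^ k  ≡⟨ cong (2 ^ (s * k) +_) (ℕₚ.^-*-assoc 2 s k) ⟩
    2 ^ (s * k) + 2 ^ (s * k)  ≡⟨ cong (2 ^ (s * k) +_) (sym (ℕₚ.+-identityʳ (2 ^ (s * k)))) ⟩
    2 ^ suc (s * k)            ∎
  expand : ∀ s k → suc (s * k) + (s + k) ≡ suc s * suc k
  expand = solve-∀
  regroup : ∀ a b x → a * b * (x + x) ≡ 2 * a * b * x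
  regroup = solve-∀

-- The exponent is `p / q`, with both sides raised to the power `q`. The floor `1` matters at
-- sparsity one: a single variable has logarithm `0` but monotone block sensitivity `1`.
MbsBound : ℕ → ℕ → ℕ → Set
MbsBound p q C = ∀ (n : ℕ) (f : BoolFun n) (c : Coeffs n) (m : ℕ) →
  IsMultilinearRep f c → IsMbs f m → m ^ q ≤ C * (1 ⊔ ⌈log₂ spar c ⌉) ^ p

-- `C` and `s` enter the bounds for the iterates of `g` only through a factor independent of `k`,
-- which `^-bound⇒≤` eliminates.
arity-bound : ∀ p q C → MbsBound p q C → ∀ {s} d .{{_ : NonZero d}} (g : BoolFun s) →
  Deg≤ d ⟦ g ⟧ → SensitiveToUnits g → s ^ q ≤ d ^ p
arity-bound p q C mbs-bound {s} d g deg-g sens-g =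
  ^-bound⇒≤ {A = C * (2 * suc s) ^ p} {p} {{ℕₚ.m^n≢0 d p}} growth
  where
  open ℕₚ.≤-Reasoning
  growth : ∀ k → (s ^ q) ^ k ≤ C * (2 * suc s) ^ p * suc k ^ p * (d ^ p) ^ k
  growth k = begin
    (s ^ q) ^ k
      ≡⟨ ^-comm s q k ⟩
    (s ^ k) ^ q
      ≤⟨ mbs-bound (s ^ k) h (coeffs ⟦ h ⟧) (s ^ k) (evalML-coeffs ⟦ h ⟧)
           (mbs-sensitiveToUnits (iterate-sensitiveToUnits g sens-g k)) ⟩
    C * (1 ⊔ ⌈log₂ spar (coeffs ⟦ h ⟧) ⌉) ^ p
      ≤⟨ ℕₚ.*-monoʳ-≤ C (ℕₚ.^-monoˡ-≤ p
           (log-spar-bound s k d (spar-coeffs {F = ⟦ h ⟧} (iterate-Deg≤ d g deg-g k)))) ⟩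
    C * (2 * suc s * suc k * d ^ k) ^ p
      ≡⟨ cong (C *_) (^-distribʳ-* p (2 * suc s * suc k) (d ^ k)) ⟩
    C * ((2 * suc s * suc k) ^ p * (d ^ k) ^ p)
      ≡⟨ cong₂ (λ y z → C * (y * z)) (^-distribʳ-* p (2 * suc s) (suc k)) (^-comm d k p) ⟩
    C * ((2 * suc s) ^ p * suc k ^ p * (d ^ p) ^ k)
      ≡⟨ reassoc C ((2 * suc s) ^ p) (suc k ^ p) ((d ^ p) ^ k) ⟩
    C * (2 * suc s) ^ p * suc k ^ p * (d ^ p) ^ k ∎
    where
    h = iterate g k
    reassoc : ∀ a b c e → a * (b * c * e) ≡ a * b * c * e
    reassoc = solve-∀

-- `sensAt f x` is by definition the length of the list that `ι` enumerates, hence the arity of the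
-- localised function.
sensAt-bound : ∀ p q C → MbsBound p q C → ∀ {n} d .{{_ : NonZero d}} (f : BoolFun n) →
  Deg≤ d ⟦ f ⟧ → ∀ x → sensAt f x ^ q ≤ d ^ p
sensAt-bound p q C mbs-bound {n} d f deg-f x = arity-bound p q C mbs-bound d (localise f x ι)
  (localise-Deg≤ f x ι d deg-f)
  (localise-sensitiveToUnits f x ι (lookup-injective (filter⁺ sensitive? (allFin⁺ n)))
    (λ j → proj₂ (∈-filter⁻ sensitive? {xs = allFin n} (∈-lookup j))))
  where
  sensitive? = λ i → ¬? (f (flipBit i x) Bool.≟ f x)
  ι = List.lookup (filter sensitive? (allFin n))

theorem2 : (p q : ℕ) → 1 ≤ q →
    (∃[ C ] ∀ (n : ℕ) (f : BoolFun n) (c : Coeffs n) (m : ℕ) →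
    IsMultilinearRep f c → IsMbs f m →
    m ^ q ≤ C * (1 ⊔ ⌈log₂ spar c ⌉) ^ p) →
    ∃[ D ] ∀ (n : ℕ) (f : BoolFun n) (c : Coeffs n) →
    IsMultilinearRep f c →
    sens f ^ q ≤ D * (1 ⊔ deg c) ^ p
-- Iteration has absorbed `C`, so the constant is `1`. The floor in `1 ⊔ deg c` keeps the degree
-- bound positive for constant functions, as `arity-bound` requires.
theorem2 p (suc q) _ (C , mbs-bound) = 1 , λ n f c rep →
  let d = 1 ⊔ deg c
      instance d≢0 = >-nonZero (ℕₚ.m≤m⊔n 1 (deg c))
  in ≤-trans
    -- `z≤n` settles the default `0` because `0 ^ suc q` computes to `0`.
    (maxList-map-elim (λ m → m ^ suc q ≤ d ^ p) z≤n
      (sensAt-bound p (suc q) C mbs-bound d f (Deg≤-rep f c rep (ℕₚ.m≤n⊔m 1 (deg c)))) (allVecs n))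
    (ℕₚ.≤-reflexive (sym (ℕₚ.*-identityˡ (d ^ p))))
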